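{- Let $A=\{a_1,a_2,\ldots,a_k\}$ be a set of $k\ge1$ distinct positive integers, let $\alpha$ be a positive integer with $\alpha\le k$, let $\tau$ be a permutation of $\{1,2,\ldots,k\}$, and let $A_{\tau(j)}=\{a_{\tau(1)},\ldots,a_{\tau(j)}\}$ for $j=1,\ldots,k$, with $A_{\tau(0)}=\emptyset$. Then \[ (a)\quad f(A)= \sum_{j=1}^k \sum_{ d\mid a_{\tau(j)} } \mu(d)\, 2^{v(A_{\tau(j-1)},d)}, \] \[ (b) \quad f_{\alpha}(A) = \sum_{j=1}^k \sum_{ d\mid a_{\tau(j)} } \mu(d) \binom{v(A_{\tau(j-1)},d)}{\alpha -1}. \]
   Context: $\mu$ is the Möbius function. For a finite set $B$ of positive integers and a positive integer $d$, $v(B,d)$ is the number of multiples of $d$ in $B$ (so $v(\emptyset,d)=0$). $f(A)$ is the number of nonempty subsets $X\subseteq A$ with $\gcd(X)=1$, and $f_\alpha(A)$ is the number of subsets $X\subseteq A$ with $|X|=\alpha$ and $\gcd(X)=1$. Binomial coefficients satisfy $\binom{m}{0}=1$ and $\binom{m}{k}=0$ when $k>m$. -}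

module Defs where

open import Data.Fin.Base using (Fin; toℕ; inject!)
open import Data.Fin.Permutation using (Permutation′; _⟨$⟩ʳ_)
open import Data.Fin.Subset using (Subset; inside; outside; ∣_∣)
open import Data.Fin.Subset.Properties using (_∈?_; nonempty?)
open import Data.Integer.Base as ℤ using (ℤ; 0ℤ; -1ℤ)
open import Data.List.Base
  using (List; []; _∷_; _++_; map; foldr; filter; length; allFin; applyUpTo)
open import Data.List.Relation.Unary.Unique.DecPropositional using (unique?)
open import Data.Nat.Base using (ℕ; zero; suc)
open import Data.Nat.Divisibility using (_∣?_)
open import Data.Nat.GCD using (gcd)
open import Data.Nat.Primality.Factorisation using (factorise; factors)
import Data.Nat.Properties as ℕ
open import Data.Vec.Base as Vec using ()
open import Data.Vec.Functional as Vector using (Vector)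
open import Data.Bool.Base using (if_then_else_)
open import Relation.Nullary.Decidable using (_×-dec_; does)

∑ : ∀ {A : Set} → List A → (A → ℤ) → ℤ
∑ xs f = foldr ℤ._+_ 0ℤ (map f xs)

syntax ∑ xs (λ x → e) = ∑[ x ∈ xs ] e

-- The positive divisors of n, each listed once (for n > 0).
divisors : ℕ → List ℕ
divisors n = filter (_∣? n) (applyUpTo suc n)

-- (-1)ʳ if n is a product of r distinct primes, and 0 if some prime occurs
-- twice in the factorisation of n.  The value at 0 is a dummy.
μ : ℕ → ℤ
μ zero = 0ℤ
μ n@(suc _) =
  if does (unique? ℕ._≟_ ps) then -1ℤ ℤ.^ length ps else 0ℤ
  where ps = factors (factorise n)

-- A finite set of m positive integers is given by an enumeration without
-- repetition, i.e. an injective family Vector ℕ m = (Fin m → ℕ) with positive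
-- values.  Its subsets are then in bijection with the sets of indices Subset m.

v : ∀ {m} → Vector ℕ m → ℕ → ℕ
v B d = length (filter (d ∣?_) (Vector.toList B))

subsets : ∀ m → List (Subset m)
subsets zero    = Vec.[] ∷ []
subsets (suc m) = map (outside Vec.∷_) (subsets m) ++ map (inside Vec.∷_) (subsets m)

-- The gcd of { a i | i ∈ X }; equal to 0 when X is empty.
gcdOf : ∀ {m} → Vector ℕ m → Subset m → ℕ
gcdOf a X = foldr gcd 0 (map a (filter (_∈? X) (allFin _)))

f : ∀ {m} → Vector ℕ m → ℕ
f {m} a = length (filter (λ X → nonempty? X ×-dec (gcdOf a X ℕ.≟ 1)) (subsets m))

fₐ : ∀ {m} → ℕ → Vector ℕ m → ℕ
fₐ {m} α a = length (filter (λ X → (∣ X ∣ ℕ.≟ α) ×-dec (gcdOf a X ℕ.≟ 1)) (subsets m))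

-- initial a τ j is { a (τ 1), …, a (τ j) } for 0 ≤ j ≤ k.
initial : ∀ {k} → Vector ℕ k → Permutation′ k → (j : Fin (suc k)) → Vector ℕ (toℕ j)
initial a τ j i = a (τ ⟨$⟩ʳ inject! i)

{-# OPTIONS --safe #-}

-- Möbius inversion turns the number of subsets X with gcd 1, weighted by w ∣X∣,
-- into ∑ μ(d) G(v(A,d)) with G n = ∑ᵢ (n C i) w i, provided w 0 = 0.  Since
-- G (n + 1) − G n is the analogous sum for the shifted weight w ∘ suc, adding the
-- elements of A one at a time in the order τ telescopes G(v(A,d)) − G(0) into a
-- sum over those j for which d divides the j-th element.  The weights [i > 0] and
-- [i = α] give (a) and (b).
module Submission where

open import Defs
open import Algebra.Properties.CommutativeMonoid.Sum using (sum; sum-permute)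
import Algebra.Properties.CommutativeSemigroup as CommutativeSemigroup
open import Data.Bool.Base using (Bool; true; false; if_then_else_; _∧_)
open import Data.Fin.Base using (Fin; zero; suc; inject₁; inject!)
open import Data.Fin.Permutation using (Permutation′; _⟨$⟩ʳ_)
open import Data.Fin.Subset using (Subset; Nonempty; inside; outside; ∣_∣)
open import Data.Fin.Subset.Properties
  using (_∈?_; nonempty?; Empty-unique; ∣⊥∣≡0; x∈p⇒∣p-x∣<∣p∣)
open import Data.Integer.Base as ℤ using (ℤ; 0ℤ; 1ℤ; -1ℤ; +_; -_; _+_; _*_)
import Data.Integer.Properties as ℤ
open import Data.List.Base
  using (List; []; _∷_; _++_; map; foldr; filter; length; allFin; tabulate; applyUpTo)
open import Data.List.Membership.Propositional using (_∈_)
open import Data.List.Properties using (map-tabulate)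
open import Data.List.Relation.Binary.Permutation.Propositional using (_↭_; ↭-sym; ↭⇒↭ₛ)
open import Data.List.Relation.Binary.Permutation.Propositional.Properties using (↭-length)
import Data.List.Relation.Binary.Permutation.Setoid.Properties as ↭ₛ
open import Data.List.Relation.Unary.All as All using (_∷_)
open import Data.List.Relation.Unary.AllPairs using (_∷_)
open import Data.List.Relation.Unary.Unique.DecPropositional using (unique?)
open import Data.Nat.Base as ℕ using (ℕ; zero; suc; _≤_; _<_; NonZero; _∸_; _^_; _⊔_)
open import Data.Nat.Combinatorics using (_C_; nCk+nC[k+1]≡[n+1]C[k+1])
open import Data.Nat.Divisibility
open import Data.Nat.GCD using (gcd; gcd[m,n]∣m; gcd[m,n]∣n; gcd-greatest; gcd[m,n]≡0⇒m≡0)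
open import Data.Nat.ListAction using (product)
open import Data.Nat.ListAction.Properties using (∈⇒∣product)
open import Data.Nat.Primality using (Prime; prime⇒nonZero; euclidsLemma)
open import Data.Nat.Primality.Factorisation
import Data.Nat.Properties as ℕ
open import Data.Product.Base using (_×_; _,_; ∃)
open import Data.Sum.Base using (inj₁; inj₂)
import Data.Vec.Base as Vec
open import Data.Vec.Functional as Vector using (Vector; tail)
open import Function.Base using (_∘_; id)
open import Function.Bundles using (_⇔_; mk⇔)
open import Function.Definitions using (Injective)
open import Relation.Binary.PropositionalEquality
  using (_≡_; refl; sym; trans; cong; cong₂; subst; setoid; module ≡-Reasoning)
open import Relation.Nullary using (¬_; Dec; yes; no; does; contradiction)
open import Relation.Nullary.Decidable
  using (dec-true; dec-false; does-⇔; decidable-stable; _×-dec_)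
open import Relation.Unary using (Decidable)

open CommutativeSemigroup ℤ.+-commutativeSemigroup using (interchange)
open CommutativeSemigroup ℤ.*-commutativeSemigroup using (x∙yz≈y∙xz; x∙yz≈z∙xy)
open PrimeFactorisation using (isFactorisation; factorsPrime)
open ≡-Reasoning

private
  variable
    A B : Set
    m n p : ℕ

-- Finite integer sums over lists.

𝟙 : Bool → ℤ
𝟙 b = if b then 1ℤ else 0ℤ

∑-cong : ∀ (xs : List A) {F G : A → ℤ} → (∀ x → F x ≡ G x) → ∑ xs F ≡ ∑ xs G
∑-cong []       F≗G = refl
∑-cong (x ∷ xs) F≗G = cong₂ _+_ (F≗G x) (∑-cong xs F≗G)

∑-zero : ∀ (xs : List A) → ∑[ x ∈ xs ] 0ℤ ≡ 0ℤ
∑-zero []       = refl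
∑-zero (x ∷ xs) = trans (ℤ.+-identityˡ _) (∑-zero xs)

∑-++ : ∀ (xs ys : List A) F → ∑ (xs ++ ys) F ≡ ∑ xs F + ∑ ys F
∑-++ []       ys F = sym (ℤ.+-identityˡ _)
∑-++ (x ∷ xs) ys F = trans (cong (_+_ (F x)) (∑-++ xs ys F)) (sym (ℤ.+-assoc (F x) _ _))

∑-map : ∀ (g : A → B) xs F → ∑ (map g xs) F ≡ ∑ xs (F ∘ g)
∑-map g []       F = refl
∑-map g (x ∷ xs) F = cong (_+_ (F (g x))) (∑-map g xs F)

∑-+ : ∀ (xs : List A) F G → ∑[ x ∈ xs ] (F x + G x) ≡ ∑ xs F + ∑ xs G
∑-+ []       F G = refl
∑-+ (x ∷ xs) F G = trans (cong (_+_ (F x + G x)) (∑-+ xs F G)) (interchange (F x) (G x) _ _)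

∑-*ˡ : ∀ (xs : List A) c F → ∑[ x ∈ xs ] (c * F x) ≡ c * ∑ xs F
∑-*ˡ []       c F = sym (ℤ.*-zeroʳ c)
∑-*ˡ (x ∷ xs) c F = trans (cong (_+_ (c * F x)) (∑-*ˡ xs c F)) (sym (ℤ.*-distribˡ-+ c (F x) _))

∑-swap : ∀ (xs : List A) (ys : List B) (F : A → B → ℤ) →
         ∑[ x ∈ xs ] ∑[ y ∈ ys ] F x y ≡ ∑[ y ∈ ys ] ∑[ x ∈ xs ] F x y
∑-swap []       ys F = sym (∑-zero ys)
∑-swap (x ∷ xs) ys F = trans (cong (_+_ (∑ ys (F x))) (∑-swap xs ys F))
                             (sym (∑-+ ys (F x) (λ y → ∑[ x ∈ xs ] F x y)))

∑-filter : ∀ {P : A → Set} (P? : Decidable P) xs F →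
           ∑ (filter P? xs) F ≡ ∑[ x ∈ xs ] (𝟙 (does (P? x)) * F x)
∑-filter P? []       F = refl
∑-filter P? (x ∷ xs) F with does (P? x)
... | true  = cong₂ _+_ (sym (ℤ.*-identityˡ (F x))) (∑-filter P? xs F)
... | false = trans (∑-filter P? xs F) (sym (ℤ.+-identityˡ _))

length-filter≡∑ : ∀ {P : A → Set} (P? : Decidable P) xs →
                  + length (filter P? xs) ≡ ∑[ x ∈ xs ] 𝟙 (does (P? x))
length-filter≡∑ P? []       = refl
length-filter≡∑ P? (x ∷ xs) with does (P? x)
... | true  = cong (_+_ 1ℤ) (length-filter≡∑ P? xs)
... | false = trans (length-filter≡∑ P? xs) (sym (ℤ.+-identityˡ _))

∑-applyUpTo-zero : ∀ (g : ℕ → ℕ) n {F} → (∀ i → i < n → F (g i) ≡ 0ℤ) →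
                   ∑ (applyUpTo g n) F ≡ 0ℤ
∑-applyUpTo-zero g zero    eq = refl
∑-applyUpTo-zero g (suc n) eq =
  cong₂ _+_ (eq 0 (ℕ.s≤s ℕ.z≤n)) (∑-applyUpTo-zero (g ∘ suc) n λ i i<n → eq (suc i) (ℕ.s≤s i<n))

∑-applyUpTo-+ : ∀ (g : ℕ → ℕ) m n F →
                ∑ (applyUpTo g (m ℕ.+ n)) F
                ≡ ∑ (applyUpTo g m) F + ∑ (applyUpTo (λ i → g (m ℕ.+ i)) n) F
∑-applyUpTo-+ g zero    n F = sym (ℤ.+-identityˡ _)
∑-applyUpTo-+ g (suc m) n F =
  trans (cong (_+_ (F (g 0))) (∑-applyUpTo-+ (g ∘ suc) m n F)) (sym (ℤ.+-assoc (F (g 0)) _ _))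

-- Sums over divisors and over multiples.

[1⋯_] : ℕ → List ℕ
[1⋯ n ] = applyUpTo suc n

-- No `d > n` divides the nonzero `n`, so the added terms vanish. This gives divisor sums of
-- different numbers one common range, which does not depend on the number and so allows
-- interchanging sums.
∑-∣-extend : ∀ {N} .{{_ : NonZero n}} → n ≤ N → ∀ (F : ℕ → ℤ) →
             ∑[ d ∈ [1⋯ N ] ] (𝟙 (does (d ∣? n)) * F d) ≡ ∑[ d ∈ [1⋯ n ] ] (𝟙 (does (d ∣? n)) * F d)
∑-∣-extend {n} {N} n≤N F = begin
  ∑ [1⋯ N ] G                ≡⟨ cong (λ k → ∑ [1⋯ k ] G) (sym (ℕ.m+[n∸m]≡n n≤N)) ⟩
  ∑ [1⋯ n ℕ.+ (N ℕ.∸ n) ] G  ≡⟨ ∑-applyUpTo-+ suc n (N ℕ.∸ n) G ⟩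
  ∑ [1⋯ n ] G + ∑ (applyUpTo (λ i → suc (n ℕ.+ i)) (N ℕ.∸ n)) G
    ≡⟨ cong (_+_ (∑ [1⋯ n ] G)) (∑-applyUpTo-zero _ (N ℕ.∸ n) λ i _ →
         cong (λ b → 𝟙 b * F (suc (n ℕ.+ i))) (dec-false (_ ∣? n) (>⇒∤ (ℕ.s≤s (ℕ.m≤m+n n i))))) ⟩
  ∑ [1⋯ n ] G + 0ℤ           ≡⟨ ℤ.+-identityʳ _ ⟩
  ∑ [1⋯ n ] G                ∎
  where
  G : ℕ → ℤ
  G d = 𝟙 (does (d ∣? n)) * F d

∑-divisors : ∀ {N} .{{_ : NonZero n}} → n ≤ N → ∀ (F : ℕ → ℤ) →
             ∑ (divisors n) F ≡ ∑[ d ∈ [1⋯ N ] ] (𝟙 (does (d ∣? n)) * F d)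
∑-divisors {n} n≤N F = trans (∑-filter (_∣? n) [1⋯ n ] F) (sym (∑-∣-extend n≤N F))

-- Induction on `m`: of the `p` consecutive numbers after `p * m`, only the last is a multiple of
-- `p`.
∑-multiples : ∀ p .{{_ : NonZero p}} m (F : ℕ → ℤ) →
              ∑[ d ∈ [1⋯ p ℕ.* m ] ] (𝟙 (does (p ∣? d)) * F d) ≡ ∑[ d ∈ [1⋯ m ] ] F (p ℕ.* d)
∑-multiples p zero F rewrite ℕ.*-zeroʳ p = refl
∑-multiples p@(suc q) (suc m) F = begin
  ∑ [1⋯ p ℕ.* suc m ] G
    ≡⟨ cong (λ k → ∑ [1⋯ k ] G)
         (trans (ℕ.*-suc p m) (trans (ℕ.+-comm p _) (cong (p ℕ.* m ℕ.+_) (ℕ.+-comm 1 q)))) ⟩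
  ∑ [1⋯ p ℕ.* m ℕ.+ (q ℕ.+ 1) ] G
    ≡⟨ ∑-applyUpTo-+ suc (p ℕ.* m) (q ℕ.+ 1) G ⟩
  ∑ [1⋯ p ℕ.* m ] G + ∑ (applyUpTo g (q ℕ.+ 1)) G
    ≡⟨ cong₂ _+_ (∑-multiples p m F) (∑-applyUpTo-+ g q 1 G) ⟩
  ∑ [1⋯ m ] F′ + (∑ (applyUpTo g q) G + (G (g (q ℕ.+ 0)) + 0ℤ))
    ≡⟨ cong (_+_ (∑ [1⋯ m ] F′)) (cong₂ _+_ (∑-applyUpTo-zero g q non-multiple) (cong (_+ 0ℤ) last)) ⟩
  ∑ [1⋯ m ] F′ + (0ℤ + (F′ (suc m) + 0ℤ))
    ≡⟨ cong (_+_ (∑ [1⋯ m ] F′)) (trans (ℤ.+-identityˡ _) (cong (λ k → F′ (suc k) + 0ℤ) (sym (ℕ.+-identityʳ m)))) ⟩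
  ∑ [1⋯ m ] F′ + ∑ (applyUpTo (λ i → suc (m ℕ.+ i)) 1) F′
    ≡⟨ ∑-applyUpTo-+ suc m 1 F′ ⟨
  ∑ [1⋯ m ℕ.+ 1 ] F′
    ≡⟨ cong (λ k → ∑ [1⋯ k ] F′) (ℕ.+-comm m 1) ⟩
  ∑ [1⋯ suc m ] F′ ∎
  where
  G F′ : ℕ → ℤ
  G d = 𝟙 (does (p ∣? d)) * F d
  F′ d = F (p ℕ.* d)
  g : ℕ → ℕ
  g i = suc (p ℕ.* m ℕ.+ i)
  non-multiple : ∀ i → i < q → G (g i) ≡ 0ℤ
  -- If `p` divided `p * m + suc i`, it would divide `suc i`, which is positive and less than `p`.
  non-multiple i i<q = cong (λ b → 𝟙 b * F (g i)) (dec-false (p ∣? g i) λ p∣ →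
    >⇒∤ (ℕ.s≤s i<q) (∣m+n∣m⇒∣n (subst (p ∣_) (sym (ℕ.+-suc (p ℕ.* m) i)) p∣) (m∣m*n m)))
  last : G (g (q ℕ.+ 0)) ≡ F′ (suc m)
  last = begin
    G (g (q ℕ.+ 0))   ≡⟨ cong G (trans (cong g (ℕ.+-identityʳ q))
                          (trans (sym (ℕ.+-suc (p ℕ.* m) q)) (trans (ℕ.+-comm (p ℕ.* m) p) (sym (ℕ.*-suc p m))))) ⟩
    G (p ℕ.* suc m)   ≡⟨ cong (λ b → 𝟙 b * F′ (suc m)) (dec-true (p ∣? _) (m∣m*n (suc m))) ⟩
    1ℤ * F′ (suc m)   ≡⟨ ℤ.*-identityˡ _ ⟩
    F′ (suc m)        ∎

-- The Möbius function and its divisor sum.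

μ-list : List ℕ → ℤ
μ-list ps = if does (unique? ℕ._≟_ ps) then -1ℤ ℤ.^ length ps else 0ℤ

μ-list-↭ : ∀ {ps qs} → ps ↭ qs → μ-list ps ≡ μ-list qs
μ-list-↭ {ps} {qs} ps↭qs = cong₂ (λ b l → if b then -1ℤ ℤ.^ l else 0ℤ)
  (does-⇔ (mk⇔ (resp (↭⇒↭ₛ ps↭qs)) (resp (↭⇒↭ₛ (↭-sym ps↭qs)))) (unique? ℕ._≟_ ps) (unique? ℕ._≟_ qs))
  (↭-length ps↭qs)
  where resp = ↭ₛ.Unique-resp-↭ (setoid ℕ)

-- Prime factorisations are unique up to permutation, and neither distinctness nor length sees the
-- order, so `μ` may be read off any factorisation, not only the one computed by `factorise`.
μ≡μ-list : .{{_ : NonZero n}} (ψ : PrimeFactorisation n) → μ n ≡ μ-list (factors ψ)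
μ≡μ-list {suc n} ψ = μ-list-↭ (factorisationUnique (factorise (suc n)) ψ)

-- Prepending `p` to the factorisation of `n` factorises `p * n`. If `p ∣ n`, then `p` now occurs
-- twice; otherwise distinctness is unaffected and the extra factor flips the sign.
μ-prime-* : Prime p → .{{_ : NonZero n}} → μ (p ℕ.* n) ≡ (if does (p ∣? n) then 0ℤ else - μ n)
μ-prime-* {p} {n} pp = trans (μ≡μ-list φ) (by-cases (p ∣? n))
  where
  instance
    _ = prime⇒nonZero pp
    _ = ℕ.m*n≢0 p n
  ψ = factorise n
  ps = factors ψ
  φ : PrimeFactorisation (p ℕ.* n)
  φ = record { factors = p ∷ ps
             ; isFactorisation = cong (p ℕ.*_) (isFactorisation ψ)
             ; factorsPrime = pp ∷ factorsPrime ψ }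
  by-cases : (p∣?n : Dec (p ∣ n)) → μ-list (p ∷ ps) ≡ (if does p∣?n then 0ℤ else - μ n)
  by-cases (yes p∣n) = cong (λ b → if b then _ else _)
    (dec-false (unique? ℕ._≟_ (p ∷ ps)) λ { (p∉ps ∷ _) → All.lookup p∉ps p∈ps refl })
    where
    p∈ps : p ∈ ps
    p∈ps = factorisationHasAllPrimeFactors pp (subst (p ∣_) (isFactorisation ψ) p∣n) (factorsPrime ψ)
  by-cases (no p∤n) = begin
    (if does (unique? ℕ._≟_ (p ∷ ps)) then -1ℤ * -1ℤ ℤ.^ length ps else 0ℤ)
      ≡⟨ cong (λ b → if b then _ else _)
           (does-⇔ (mk⇔ (λ { (_ ∷ u) → u }) (p∉ps ∷_)) (unique? ℕ._≟_ (p ∷ ps)) (unique? ℕ._≟_ ps)) ⟩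
    (if does (unique? ℕ._≟_ ps) then -1ℤ * -1ℤ ℤ.^ length ps else 0ℤ)
      ≡⟨ push (does (unique? ℕ._≟_ ps)) ⟩
    - μ-list ps  ≡⟨ cong -_ (μ≡μ-list ψ) ⟨
    - μ n        ∎
    where
    p∉ps = All.tabulate λ {q} q∈ps p≡q →
      p∤n (subst (p ∣_) (sym (isFactorisation ψ)) (subst (_∣ product ps) (sym p≡q) (∈⇒∣product q∈ps)))
    push : ∀ b → (if b then -1ℤ * -1ℤ ℤ.^ length ps else 0ℤ) ≡ - (if b then -1ℤ ℤ.^ length ps else 0ℤ)
    push true  = ℤ.-1*i≡-i _
    push false = refl

∃-prime-factor : .{{_ : NonZero n}} → ¬ n ≡ 1 → ∃ λ p → Prime p × p ∣ n
∃-prime-factor {n} n≢1 with factorise n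
... | record { factors = []    ; isFactorisation = eq } = contradiction eq n≢1
... | record { factors = q ∷ qs; isFactorisation = eq; factorsPrime = pq ∷ _ } =
  q , pq , subst (q ∣_) (sym eq) (m∣m*n (product qs))

-- The terms at d and p * d cancel when p ∤ d, and the remaining terms p² ∣ d vanish.
∑μ-prime-* : Prime p → ∀ m .{{_ : NonZero m}} →
             ∑[ d ∈ [1⋯ p ℕ.* m ] ] (𝟙 (does (d ∣? p ℕ.* m)) * μ d) ≡ 0ℤ
∑μ-prime-* {p} pp m = begin
  ∑ [1⋯ p ℕ.* m ] (λ d → 𝟙 (does (d ∣? p ℕ.* m)) * μ d)
    ≡⟨ ∑-cong [1⋯ p ℕ.* m ] split ⟩
  ∑ [1⋯ p ℕ.* m ] (λ d → 𝟙 (does (p ∣? d)) * F d + 𝟙 (does (d ∣? m)) * H d)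
    ≡⟨ ∑-+ [1⋯ p ℕ.* m ] _ _ ⟩
  ∑ [1⋯ p ℕ.* m ] (λ d → 𝟙 (does (p ∣? d)) * F d) + ∑ [1⋯ p ℕ.* m ] (λ d → 𝟙 (does (d ∣? m)) * H d)
    -- Both ranges shrink to `[1⋯ m ]`: multiples of `p` are written as `p * d`, and divisors of `m`
    -- do not exceed `m`.
    ≡⟨ cong₂ _+_ (∑-multiples p m F) (∑-∣-extend (ℕ.m≤n*m m p) H) ⟩
  ∑ [1⋯ m ] (λ d → F (p ℕ.* d)) + ∑ [1⋯ m ] (λ d → 𝟙 (does (d ∣? m)) * H d)
    ≡⟨ ∑-+ [1⋯ m ] _ _ ⟨
  ∑ [1⋯ m ] (λ d → F (p ℕ.* d) + 𝟙 (does (d ∣? m)) * H d)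
    ≡⟨ ∑-applyUpTo-zero suc m (λ i _ → cancel (suc i)) ⟩
  0ℤ ∎
  where
  instance _ = prime⇒nonZero pp
  F H : ℕ → ℤ
  F d = 𝟙 (does (d ∣? p ℕ.* m)) * μ d
  -- `H` is `μ` cut off at the multiples of `p`, so the second summand of `split` carries exactly
  -- the divisors not divisible by `p`.
  H d = if does (p ∣? d) then 0ℤ else μ d
  split : ∀ d → F d ≡ 𝟙 (does (p ∣? d)) * F d + 𝟙 (does (d ∣? m)) * H d
  split d with p ∣? d
  ... | yes p∣d = sym (trans (cong₂ _+_ (ℤ.*-identityˡ (F d)) (ℤ.*-zeroʳ (𝟙 (does (d ∣? m))))) (ℤ.+-identityʳ _))
  ... | no  p∤d = trans (cong (λ b → 𝟙 b * μ d) (does-⇔ (mk⇔ cancel-p (∣n⇒∣m*n p)) (d ∣? p ℕ.* m) (d ∣? m)))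
                        (sym (ℤ.+-identityˡ _))
    where
    cancel-p : d ∣ p ℕ.* m → d ∣ m
    -- `p` divides `q * d` but not `d`, hence `q ≡ r * p` by Euclid's lemma; cancelling `p` leaves
    -- `m ≡ r * d`.
    cancel-p (divides q pm≡qd) with euclidsLemma q d pp (subst (p ∣_) pm≡qd (m∣m*n m))
    ... | inj₂ p∣d = contradiction p∣d p∤d
    ... | inj₁ (divides r q≡rp) = divides r (ℕ.*-cancelˡ-≡ m (r ℕ.* d) p (begin
      p ℕ.* m          ≡⟨ pm≡qd ⟩
      q ℕ.* d          ≡⟨ cong (ℕ._* d) (trans q≡rp (ℕ.*-comm r p)) ⟩
      p ℕ.* r ℕ.* d    ≡⟨ ℕ.*-assoc p r d ⟩
      p ℕ.* (r ℕ.* d)  ∎))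
  cancel : ∀ d .{{_ : NonZero d}} → F (p ℕ.* d) + 𝟙 (does (d ∣? m)) * H d ≡ 0ℤ
  cancel d = begin
    𝟙 (does (p ℕ.* d ∣? p ℕ.* m)) * μ (p ℕ.* d) + 𝟙 (does (d ∣? m)) * H d
      ≡⟨ cong₂ (λ b i → 𝟙 b * i + 𝟙 (does (d ∣? m)) * H d)
           (does-⇔ (mk⇔ (*-cancelˡ-∣ p) (*-monoʳ-∣ p)) (p ℕ.* d ∣? p ℕ.* m) (d ∣? m)) (μ-prime-* {p} {d} pp) ⟩
    𝟙 (does (d ∣? m)) * (if does (p ∣? d) then 0ℤ else - μ d) + 𝟙 (does (d ∣? m)) * H d
      ≡⟨ ℤ.*-distribˡ-+ (𝟙 (does (d ∣? m))) _ (H d) ⟨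
    𝟙 (does (d ∣? m)) * ((if does (p ∣? d) then 0ℤ else - μ d) + H d)
      ≡⟨ cong (𝟙 (does (d ∣? m)) *_) (opposite (does (p ∣? d))) ⟩
    𝟙 (does (d ∣? m)) * 0ℤ
      ≡⟨ ℤ.*-zeroʳ (𝟙 (does (d ∣? m))) ⟩
    0ℤ ∎
    where
    opposite : ∀ b → (if b then 0ℤ else - μ d) + (if b then 0ℤ else μ d) ≡ 0ℤ
    opposite true  = refl
    opposite false = ℤ.+-inverseˡ (μ d)

∑μ : ∀ n .{{_ : NonZero n}} → ∑[ d ∈ [1⋯ n ] ] (𝟙 (does (d ∣? n)) * μ d) ≡ 𝟙 (does (n ℕ.≟ 1))
∑μ n with n ℕ.≟ 1
... | yes refl = refl
... | no  n≢1 with ∃-prime-factor {n} n≢1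
...   | p , pp , divides-refl m = begin
  ∑[ d ∈ [1⋯ m ℕ.* p ] ] (𝟙 (does (d ∣? m ℕ.* p)) * μ d)
    ≡⟨ cong (λ k → ∑[ d ∈ [1⋯ k ] ] (𝟙 (does (d ∣? k)) * μ d)) (ℕ.*-comm m p) ⟩
  ∑[ d ∈ [1⋯ p ℕ.* m ] ] (𝟙 (does (d ∣? p ℕ.* m)) * μ d)
    ≡⟨ ∑μ-prime-* pp m {{ℕ.m*n≢0⇒m≢0 m}} ⟩
  0ℤ
    ≡⟨ cong 𝟙 (dec-false (m ℕ.* p ℕ.≟ 1) n≢1) ⟨
  𝟙 (does (m ℕ.* p ℕ.≟ 1)) ∎

-- Weighted binomial sums.

-- binomialSum w n = ∑ᵢ (n C i) * w i
binomialSum : (ℕ → ℤ) → ℕ → ℤ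
binomialSum w zero    = w 0
binomialSum w (suc n) = binomialSum w n + binomialSum (w ∘ suc) n

binomialSum-zero : ∀ n → binomialSum (λ _ → 0ℤ) n ≡ 0ℤ
binomialSum-zero zero    = refl
binomialSum-zero (suc n) = cong₂ _+_ (binomialSum-zero n) (binomialSum-zero n)

binomialSum-one : ∀ n → binomialSum (λ _ → 1ℤ) n ≡ + (2 ^ n)
binomialSum-one zero    = refl
binomialSum-one (suc n) = begin
  binomialSum _ n + binomialSum _ n  ≡⟨ cong₂ _+_ (binomialSum-one n) (binomialSum-one n) ⟩
  + (2 ^ n ℕ.+ 2 ^ n)                ≡⟨ cong (λ k → + (2 ^ n ℕ.+ k)) (ℕ.+-identityʳ (2 ^ n)) ⟨
  + (2 ^ suc n)                      ∎

-- Shifting the weight `[i = k + 1]` gives `[i = k]`, so the recursion is Pascal's rule; shifting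
-- `[i = 0]` gives the zero weight.
binomialSum-indicator : ∀ k n → binomialSum (λ i → 𝟙 (does (i ℕ.≟ k))) n ≡ + (n C k)
binomialSum-indicator zero    zero    = refl
binomialSum-indicator (suc k) zero    = refl
binomialSum-indicator zero    (suc n) =
  cong₂ _+_ (binomialSum-indicator 0 n) (binomialSum-zero n)
binomialSum-indicator (suc k) (suc n) = begin
  binomialSum (λ i → 𝟙 (does (i ℕ.≟ suc k))) n + binomialSum (λ i → 𝟙 (does (i ℕ.≟ k))) n
    ≡⟨ cong₂ _+_ (binomialSum-indicator (suc k) n) (binomialSum-indicator k n) ⟩
  + (n C suc k ℕ.+ n C k)
    ≡⟨ cong +_ (trans (ℕ.+-comm (n C suc k) (n C k)) (nCk+nC[k+1]≡[n+1]C[k+1] n k)) ⟩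
  + (suc n C suc k) ∎

-- Counting multiples: reordering and telescoping.

-- As a sum in a commutative monoid, the count becomes accessible to `sum-permute`.
v≡sum : ∀ (a : Vector ℕ m) d →
        v a d ≡ sum ℕ.+-0-commutativeMonoid (λ i → if does (d ∣? a i) then 1 else 0)
v≡sum {zero}  a d = refl
v≡sum {suc m} a d with does (d ∣? a zero)
... | true  = cong suc (v≡sum (tail a) d)
... | false = v≡sum (tail a) d

v-permute : ∀ (a : Vector ℕ m) (τ : Permutation′ m) d → v (a ∘ (τ ⟨$⟩ʳ_)) d ≡ v a d
v-permute a τ d = trans (v≡sum (a ∘ (τ ⟨$⟩ʳ_)) d)
  (trans (sym (sum-permute ℕ.+-0-commutativeMonoid (λ i → if does (d ∣? a i) then 1 else 0) τ))
         (sym (v≡sum a d)))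

∑-allFin-suc : ∀ m F → ∑ (allFin (suc m)) F ≡ F zero + ∑ (allFin m) (F ∘ suc)
∑-allFin-suc m F = cong (_+_ (F zero))
  (trans (cong (λ is → ∑ is F) (sym (map-tabulate id suc))) (∑-map suc (allFin m) F))

-- The j-th summand is the increment of binomialSum w (c + v _ d) when b j joins
-- the elements before it; the offset c makes the induction on m go through.
telescope : ∀ w (b : Vector ℕ m) d c →
  binomialSum w c
    + ∑[ j ∈ allFin m ] (𝟙 (does (d ∣? b j))
                         * binomialSum (w ∘ suc) (c ℕ.+ v (λ i → b (inject! {i = inject₁ j} i)) d))
  ≡ binomialSum w (c ℕ.+ v b d)
telescope {zero}  w b d c = trans (ℤ.+-identityʳ _) (cong (binomialSum w) (sym (ℕ.+-identityʳ c)))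
telescope {suc m} w b d c = begin
  binomialSum w c + ∑ (allFin (suc m)) F
    ≡⟨ cong (_+_ (binomialSum w c)) (∑-allFin-suc m F) ⟩
  binomialSum w c + (F zero + ∑ (allFin m) (F ∘ suc))
    ≡⟨ ℤ.+-assoc (binomialSum w c) (F zero) _ ⟨
  binomialSum w c + F zero + ∑ (allFin m) (F ∘ suc)
    ≡⟨ step ⟩
  binomialSum w (c ℕ.+ v b d) ∎
  where
  F : Fin (suc m) → ℤ
  F j = 𝟙 (does (d ∣? b j)) * binomialSum (w ∘ suc) (c ℕ.+ v (λ i → b (inject! {i = inject₁ j} i)) d)
  step : binomialSum w c + F zero + ∑ (allFin m) (F ∘ suc) ≡ binomialSum w (c ℕ.+ v b d)
  step with does (d ∣? b zero)
  -- Nothing precedes the first element, whence `c + 0`. Its term completes `binomialSum w c` to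
  -- `binomialSum w (suc c)` by definition, and every later count includes this element, so the
  -- offset becomes `suc c`.
  ... | true  = begin
    binomialSum w c + 1ℤ * binomialSum (w ∘ suc) (c ℕ.+ 0) + _
      ≡⟨ cong₂ (λ x y → binomialSum w c + x + y)
           (trans (ℤ.*-identityˡ _) (cong (binomialSum (w ∘ suc)) (ℕ.+-identityʳ c)))
           (∑-cong (allFin m) λ j → cong (λ k → 𝟙 (does (d ∣? b (suc j))) * binomialSum (w ∘ suc) k)
                                          (ℕ.+-suc c _)) ⟩
    binomialSum w (suc c) + _         ≡⟨ telescope w (tail b) d (suc c) ⟩
    binomialSum w (suc c ℕ.+ _)       ≡⟨ cong (binomialSum w) (ℕ.+-suc c _) ⟨
    binomialSum w (c ℕ.+ suc (v (tail b) d)) ∎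
  ... | false = trans (cong₂ _+_ (ℤ.+-identityʳ (binomialSum w c)) refl) (telescope w (tail b) d c)

-- Greatest common divisors of subsets.

-- Whether `suc i` lies in `s ∷ X` does not depend on `s`, so one lemma serves both `outside` and
-- `inside`.
map-filter-∈?-suc : ∀ (a : Vector ℕ (suc m)) s X is →
  map a (filter (_∈? (s Vec.∷ X)) (map suc is)) ≡ map (tail a) (filter (_∈? X) is)
map-filter-∈?-suc a s X []       = refl
map-filter-∈?-suc a s X (i ∷ is) with does (i ∈? X)
... | true  = cong (a (suc i) ∷_) (map-filter-∈?-suc a s X is)
... | false = map-filter-∈?-suc a s X is

map-filter-∈?-tabulate-suc : ∀ (a : Vector ℕ (suc m)) s X →
  map a (filter (_∈? (s Vec.∷ X)) (tabulate suc)) ≡ map (tail a) (filter (_∈? X) (allFin m))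
map-filter-∈?-tabulate-suc {m} a s X =
  trans (cong (λ is → map a (filter (_∈? (s Vec.∷ X)) is)) (sym (map-tabulate id suc)))
        (map-filter-∈?-suc a s X (allFin m))

gcdOf-outside : ∀ (a : Vector ℕ (suc m)) X → gcdOf a (outside Vec.∷ X) ≡ gcdOf (tail a) X
gcdOf-outside a X = cong (foldr gcd 0) (map-filter-∈?-tabulate-suc a outside X)

gcdOf-inside : ∀ (a : Vector ℕ (suc m)) X →
               gcdOf a (inside Vec.∷ X) ≡ gcd (a zero) (gcdOf (tail a) X)
gcdOf-inside a X = cong (λ xs → gcd (a zero) (foldr gcd 0 xs)) (map-filter-∈?-tabulate-suc a inside X)

-- A zero gcd would force each chosen element to be zero. This isolates the empty set, the only case
-- where the divisor sum of `μ` cannot be applied to the gcd.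
gcdOf≡0⇒∣X∣≡0 : ∀ (a : Vector ℕ m) → (∀ i → 0 < a i) → ∀ X → gcdOf a X ≡ 0 → ∣ X ∣ ≡ 0
gcdOf≡0⇒∣X∣≡0 a a>0 Vec.[]            eq = refl
gcdOf≡0⇒∣X∣≡0 a a>0 (outside Vec.∷ X) eq =
  gcdOf≡0⇒∣X∣≡0 (tail a) (a>0 ∘ suc) X (trans (sym (gcdOf-outside a X)) eq)
gcdOf≡0⇒∣X∣≡0 a a>0 (inside Vec.∷ X)  eq =
  contradiction (gcd[m,n]≡0⇒m≡0 (trans (sym (gcdOf-inside a X)) eq)) (ℕ.m<n⇒n≢0 (a>0 zero))

gcdOf≤ : ∀ {N} (a : Vector ℕ m) → (∀ i → 0 < a i) → (∀ i → a i ≤ N) → ∀ X → gcdOf a X ≤ N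
gcdOf≤ a a>0 a≤N Vec.[]            = ℕ.z≤n
gcdOf≤ a a>0 a≤N (outside Vec.∷ X) =
  ℕ.≤-trans (ℕ.≤-reflexive (gcdOf-outside a X)) (gcdOf≤ (tail a) (a>0 ∘ suc) (a≤N ∘ suc) X)
gcdOf≤ a a>0 a≤N (inside Vec.∷ X)  =
  ℕ.≤-trans (ℕ.≤-reflexive (gcdOf-inside a X))
    (ℕ.≤-trans (∣⇒≤ {{ℕ.>-nonZero (a>0 zero)}} (gcd[m,n]∣m (a zero) (gcdOf (tail a) X))) (a≤N zero))

does-∣?-gcd : ∀ d m n → does (d ∣? gcd m n) ≡ does (d ∣? m) ∧ does (d ∣? n)
does-∣?-gcd d m n = does-⇔
  (mk⇔ (λ d∣g → ∣-trans d∣g (gcd[m,n]∣m m n) , ∣-trans d∣g (gcd[m,n]∣n m n))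
       (λ (d∣m , d∣n) → gcd-greatest d∣m d∣n))
  (d ∣? gcd m n) ((d ∣? m) ×-dec (d ∣? n))

-- `d` divides the gcd of `X` exactly when `X` consists of multiples of `d`, and `v a d` such
-- elements have `v a d C i` subsets of size `i`. The induction leaves out or takes in the first
-- element, matching the recursion of `binomialSum`.
∑-subsets-∣gcdOf : ∀ w (a : Vector ℕ m) d →
  ∑[ X ∈ subsets m ] (w ∣ X ∣ * 𝟙 (does (d ∣? gcdOf a X))) ≡ binomialSum w (v a d)
∑-subsets-∣gcdOf {zero}  w a d = begin
  w 0 * 𝟙 (does (d ∣? 0)) + 0ℤ  ≡⟨ ℤ.+-identityʳ _ ⟩
  -- The empty set has gcd 0, which every `d` divides.
  w 0 * 𝟙 (does (d ∣? 0))       ≡⟨ cong (λ b → w 0 * 𝟙 b) (dec-true (d ∣? 0) (d ∣0)) ⟩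
  w 0 * 1ℤ                      ≡⟨ ℤ.*-identityʳ (w 0) ⟩
  w 0                           ∎
∑-subsets-∣gcdOf {suc m} w a d = begin
  ∑ (subsets (suc m)) F
    ≡⟨ ∑-++ (map (outside Vec.∷_) (subsets m)) _ F ⟩
  ∑ (map (outside Vec.∷_) (subsets m)) F + ∑ (map (inside Vec.∷_) (subsets m)) F
    ≡⟨ cong₂ _+_ (∑-map (outside Vec.∷_) (subsets m) F) (∑-map (inside Vec.∷_) (subsets m) F) ⟩
  ∑[ X ∈ subsets m ] F (outside Vec.∷ X) + ∑[ X ∈ subsets m ] F (inside Vec.∷ X)
    ≡⟨ cong₂ _+_
         (∑-cong (subsets m) λ X → cong (λ g → w ∣ X ∣ * 𝟙 (does (d ∣? g))) (gcdOf-outside a X))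
         (∑-cong (subsets m) λ X → cong (λ b → w (suc ∣ X ∣) * 𝟙 b)
           (trans (cong (λ g → does (d ∣? g)) (gcdOf-inside a X)) (does-∣?-gcd d (a zero) (gcdOf (tail a) X)))) ⟩
  ∑[ X ∈ subsets m ] (w ∣ X ∣ * 𝟙 (does (d ∣? gcdOf (tail a) X)))
    + ∑[ X ∈ subsets m ] (w (suc ∣ X ∣) * 𝟙 (does (d ∣? a zero) ∧ does (d ∣? gcdOf (tail a) X)))
    ≡⟨ cong₂ _+_ (∑-subsets-∣gcdOf w (tail a) d) refl ⟩
  binomialSum w (v (tail a) d)
    + ∑[ X ∈ subsets m ] (w (suc ∣ X ∣) * 𝟙 (does (d ∣? a zero) ∧ does (d ∣? gcdOf (tail a) X)))
    ≡⟨ step ⟩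
  binomialSum w (v a d) ∎
  where
  F : Subset (suc m) → ℤ
  F X = w ∣ X ∣ * 𝟙 (does (d ∣? gcdOf a X))
  step : binomialSum w (v (tail a) d)
           + ∑[ X ∈ subsets m ] (w (suc ∣ X ∣) * 𝟙 (does (d ∣? a zero) ∧ does (d ∣? gcdOf (tail a) X)))
         ≡ binomialSum w (v a d)
  -- If `d ∣ a zero`, the sets containing `a zero` contribute with the weight shifted by one;
  -- otherwise they contribute nothing.
  step with does (d ∣? a zero)
  ... | true  = cong (_+_ (binomialSum w (v (tail a) d))) (∑-subsets-∣gcdOf (w ∘ suc) (tail a) d)
  ... | false = trans (cong (_+_ (binomialSum w (v (tail a) d)))
                        (trans (∑-cong (subsets m) λ X → ℤ.*-zeroʳ (w (suc ∣ X ∣))) (∑-zero (subsets m))))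
                      (ℤ.+-identityʳ _)

-- Möbius inversion and the sum along the order.

-- An upper limit for `d` that covers the divisors of all elements and of all nonzero gcds at once.
maximum : Vector ℕ m → ℕ
maximum = Vector.foldr _⊔_ 0

≤-maximum : ∀ (a : Vector ℕ m) i → a i ≤ maximum a
≤-maximum a zero    = ℕ.m≤m⊔n _ _
≤-maximum a (suc i) = ℕ.≤-trans (≤-maximum (tail a) i) (ℕ.m≤n⊔m (a zero) _)

-- The indicator of gcd 1 is replaced by the sum of `μ d` over the divisors `d` of the gcd; after
-- interchanging sums, each `d` contributes a weighted count of subsets.
∑-𝟙-gcdOf≡1 : ∀ w → w 0 ≡ 0ℤ → (a : Vector ℕ m) → (∀ i → 0 < a i) →
  ∑[ X ∈ subsets m ] (w ∣ X ∣ * 𝟙 (does (gcdOf a X ℕ.≟ 1)))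
  ≡ ∑[ d ∈ [1⋯ maximum a ] ] (μ d * binomialSum w (v a d))
∑-𝟙-gcdOf≡1 {m} w w0≡0 a a>0 = begin
  ∑[ X ∈ subsets m ] (w ∣ X ∣ * 𝟙 (does (gcdOf a X ℕ.≟ 1)))
    ≡⟨ ∑-cong (subsets m) möbius ⟩
  ∑[ X ∈ subsets m ] (w ∣ X ∣ * ∑[ d ∈ D ] (𝟙 (does (d ∣? gcdOf a X)) * μ d))
    ≡⟨ ∑-cong (subsets m) (λ X → trans (sym (∑-*ˡ D (w ∣ X ∣) _))
         (∑-cong D λ d → x∙yz≈z∙xy (w ∣ X ∣) (𝟙 (does (d ∣? gcdOf a X))) (μ d))) ⟩
  ∑[ X ∈ subsets m ] ∑[ d ∈ D ] (μ d * (w ∣ X ∣ * 𝟙 (does (d ∣? gcdOf a X))))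
    ≡⟨ ∑-swap (subsets m) D (λ X d → μ d * (w ∣ X ∣ * 𝟙 (does (d ∣? gcdOf a X)))) ⟩
  ∑[ d ∈ D ] ∑[ X ∈ subsets m ] (μ d * (w ∣ X ∣ * 𝟙 (does (d ∣? gcdOf a X))))
    ≡⟨ ∑-cong D (λ d → trans (∑-*ˡ (subsets m) (μ d) _) (cong (μ d *_) (∑-subsets-∣gcdOf w a d))) ⟩
  ∑[ d ∈ D ] (μ d * binomialSum w (v a d)) ∎
  where
  D = [1⋯ maximum a ]
  möbius : ∀ X → w ∣ X ∣ * 𝟙 (does (gcdOf a X ℕ.≟ 1))
               ≡ w ∣ X ∣ * ∑[ d ∈ D ] (𝟙 (does (d ∣? gcdOf a X)) * μ d)
  möbius X with gcdOf a X ℕ.≟ 0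
  -- Here `X` is empty, and both sides vanish because `w 0 ≡ 0ℤ`.
  ... | yes g≡0 rewrite gcdOf≡0⇒∣X∣≡0 a a>0 X g≡0 | w0≡0 = refl
  ... | no  g≢0 = cong (w ∣ X ∣ *_) (sym
    (trans (∑-∣-extend (gcdOf≤ a a>0 (≤-maximum a) X) μ) (∑μ (gcdOf a X))))
    where instance _ = ℕ.≢-nonZero g≢0

-- Interchanging the sums fixes `d`; the sum over `j` then collects the increments of
-- `binomialSum w` at the positions where `d` divides the new element.
∑-initial : ∀ w → w 0 ≡ 0ℤ → (a : Vector ℕ m) → (∀ i → 0 < a i) → (τ : Permutation′ m) →
  ∑[ j ∈ allFin m ] ∑[ d ∈ divisors (a (τ ⟨$⟩ʳ j)) ]
    (μ d * binomialSum (w ∘ suc) (v (initial a τ (inject₁ j)) d))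
  ≡ ∑[ d ∈ [1⋯ maximum a ] ] (μ d * binomialSum w (v a d))
∑-initial {m} w w0≡0 a a>0 τ = begin
  ∑[ j ∈ allFin m ] ∑[ d ∈ divisors (b j) ] (μ d * g j d)
    ≡⟨ ∑-cong (allFin m) (λ j → trans
         (∑-divisors {{ℕ.>-nonZero (a>0 _)}} (≤-maximum a (τ ⟨$⟩ʳ j)) (λ d → μ d * g j d))
         (∑-cong D λ d → x∙yz≈y∙xz (𝟙 (does (d ∣? b j))) (μ d) (g j d))) ⟩
  ∑[ j ∈ allFin m ] ∑[ d ∈ D ] (μ d * (𝟙 (does (d ∣? b j)) * g j d))
    ≡⟨ ∑-swap (allFin m) D (λ j d → μ d * (𝟙 (does (d ∣? b j)) * g j d)) ⟩
  ∑[ d ∈ D ] ∑[ j ∈ allFin m ] (μ d * (𝟙 (does (d ∣? b j)) * g j d))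
    ≡⟨ ∑-cong D (λ d → trans (∑-*ˡ (allFin m) (μ d) _) (cong (μ d *_) (increments d))) ⟩
  ∑[ d ∈ D ] (μ d * binomialSum w (v a d)) ∎
  where
  D = [1⋯ maximum a ]
  b : Vector ℕ m
  b j = a (τ ⟨$⟩ʳ j)
  g : Fin m → ℕ → ℤ
  g j d = binomialSum (w ∘ suc) (v (initial a τ (inject₁ j)) d)
  increments : ∀ d → ∑[ j ∈ allFin m ] (𝟙 (does (d ∣? b j)) * g j d) ≡ binomialSum w (v a d)
  increments d = begin
    -- The telescoping starts from `binomialSum w 0`, which is `w 0` and hence zero.
    ∑ (allFin m) _           ≡⟨ ℤ.+-identityˡ _ ⟨
    0ℤ + ∑ (allFin m) _      ≡⟨ cong₂ _+_ w0≡0 refl ⟨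
    w 0 + ∑ (allFin m) _     ≡⟨ telescope w b d 0 ⟩
    binomialSum w (v b d)    ≡⟨ cong (binomialSum w) (v-permute a τ d) ⟩
    binomialSum w (v a d)    ∎

-- The common form of both formulas: the condition `P` enters only through a weight on the
-- cardinality, and `w 0 ≡ 0ℤ` excludes the empty set.
length-filter-subsets : ∀ {P : Subset m → Set} (P? : ∀ X → Dec (P X)) w → w 0 ≡ 0ℤ →
  (∀ X → 𝟙 (does (P? X)) ≡ w ∣ X ∣) →
  (a : Vector ℕ m) → (∀ i → 0 < a i) → (τ : Permutation′ m) →
  + length (filter (λ X → P? X ×-dec (gcdOf a X ℕ.≟ 1)) (subsets m))
  ≡ ∑[ j ∈ allFin m ] ∑[ d ∈ divisors (a (τ ⟨$⟩ʳ j)) ]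
      (μ d * binomialSum (w ∘ suc) (v (initial a τ (inject₁ j)) d))
length-filter-subsets {m} P? w w0≡0 P≗w a a>0 τ = begin
  + length (filter (λ X → P? X ×-dec (gcdOf a X ℕ.≟ 1)) (subsets m))
    ≡⟨ length-filter≡∑ _ (subsets m) ⟩
  ∑[ X ∈ subsets m ] 𝟙 (does (P? X) ∧ does (gcdOf a X ℕ.≟ 1))
    ≡⟨ ∑-cong (subsets m) (λ X → trans (𝟙-∧ (does (P? X)) _) (cong (_* _) (P≗w X))) ⟩
  ∑[ X ∈ subsets m ] (w ∣ X ∣ * 𝟙 (does (gcdOf a X ℕ.≟ 1)))
    ≡⟨ ∑-𝟙-gcdOf≡1 w w0≡0 a a>0 ⟩
  ∑[ d ∈ [1⋯ maximum a ] ] (μ d * binomialSum w (v a d))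
    ≡⟨ ∑-initial w w0≡0 a a>0 τ ⟨
  _ ∎
  where
  𝟙-∧ : ∀ b c → 𝟙 (b ∧ c) ≡ 𝟙 b * 𝟙 c
  𝟙-∧ true  c = sym (ℤ.*-identityˡ (𝟙 c))
  𝟙-∧ false c = refl

-- The two choices of weight.

nonempty⇔∣p∣>0 : ∀ (X : Subset m) → Nonempty X ⇔ (0 < ∣ X ∣)
nonempty⇔∣p∣>0 {m} X = mk⇔ (λ (_ , i∈X) → ℕ.m<n⇒0<n (x∈p⇒∣p-x∣<∣p∣ i∈X)) λ ∣X∣>0 →
  decidable-stable (nonempty? X) λ empty →
    ℕ.m<n⇒n≢0 ∣X∣>0 (trans (cong ∣_∣ (Empty-unique empty)) (∣⊥∣≡0 m))

theorem3p2 : ∀ (k : ℕ) → 1 ≤ k →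
    (a : Vector ℕ k) → (∀ i → 0 < a i) → Injective _≡_ _≡_ a →
    (α : ℕ) → 1 ≤ α → α ≤ k →
    (τ : Permutation′ k) →
    (+ f a ≡ ∑[ j ∈ allFin k ] ∑[ d ∈ divisors (a (τ ⟨$⟩ʳ j)) ]
    (μ d * + (2 ^ v (initial a τ (inject₁ j)) d)))
    ×
    (+ fₐ α a ≡ ∑[ j ∈ allFin k ] ∑[ d ∈ divisors (a (τ ⟨$⟩ʳ j)) ]
    (μ d * + (v (initial a τ (inject₁ j)) d C (α ∸ 1))))
theorem3p2 k _ a a>0 _ (suc α) _ _ τ =
  -- The weight `[n > 0]` shifts to the constant 1, whose binomial sum is `2 ^ n`.
  trans (length-filter-subsets nonempty? (λ n → 𝟙 (does (0 ℕ.<? n))) refl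
           (λ X → cong 𝟙 (does-⇔ (nonempty⇔∣p∣>0 X) (nonempty? X) (0 ℕ.<? ∣ X ∣))) a a>0 τ)
        (weights λ n → binomialSum-one n) ,
  -- The size is `suc α` here, so the shifted weight is `[n = α]`, with binomial sum `n C α`, and
  -- `suc α ∸ 1` reduces to `α`.
  trans (length-filter-subsets (λ X → ∣ X ∣ ℕ.≟ suc α) (λ n → 𝟙 (does (n ℕ.≟ suc α))) refl
           (λ X → refl) a a>0 τ)
        (weights λ n → binomialSum-indicator α n)
  where
  weights : ∀ {g h : ℕ → ℤ} → (∀ n → g n ≡ h n) →
    ∑[ j ∈ allFin k ] ∑[ d ∈ divisors (a (τ ⟨$⟩ʳ j)) ] (μ d * g (v (initial a τ (inject₁ j)) d))
    ≡ ∑[ j ∈ allFin k ] ∑[ d ∈ divisors (a (τ ⟨$⟩ʳ j)) ] (μ d * h (v (initial a τ (inject₁ j)) d))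
  weights g≗h = ∑-cong (allFin k) λ j → ∑-cong (divisors (a (τ ⟨$⟩ʳ j))) λ d → cong (μ d *_) (g≗h _)
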